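{- Let $a\geq 15$ be an integer, let $\rho$ be the root greater than $a+1$ of $x^3-ax^2-(a+3)x-1$, and let $\gamma=a^2+a+8+(a^2-a+1)\rho+(2-a)\rho^2\in\mathbb{Z}[\rho]$. Let $\alpha\in\blacktriangle_0\cup\{1+\rho+\rho^2\}$. If $N(\alpha^2)\leq N(\gamma)$, then \[ \alpha\in\{ -w\rho+\rho^2 : 1\leq w\leq a\}\cup\{1+\rho+\rho^2,\,-1-(a+4)\rho+2\rho^2\}, \] where $w$ ranges over integers.
   Context: The polynomial $x^3-ax^2-(a+3)x-1$ is irreducible over $\mathbb{Q}$ with three real roots $\rho,\rho',\rho''$, labelled so that $a+1<\rho$, $-2<\rho'<-1$, $-1<\rho''<0$. $N$ denotes the norm from $\mathbb{Q}(\rho)$ to $\mathbb{Q}$, i.e. the product of the three conjugates. For integers $v,W$ with $0\leq v\leq a$ and $0\leq W\leq a-v$, put \[ \alpha(v,W)=-v-(v(a+2)+1+W)\rho+(v+1)\rho^2 . \] Write $a=3A+a_0$ with $A$ an integer and $a_0\in\{0,1,2\}$. The set $\blacktriangle_0=\blacktriangle_0(a)$ is defined (with $v,W$ integers) by \[ \blacktriangle_0=\{\alpha(v,W) : 0\leq v\leq A,\ v\leq W\leq a-2v-1\}\quad\text{if } a_0\in\{1,2\}, \] \[ \blacktriangle_0=\{\alpha(v,W) : 0\leq v\leq A-1,\ v\leq W\leq a-2v-1\}\cup\{\alpha(A,A)\}\quad\text{if } a_0=0. \] -}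

module Defs where

open import Data.Integer using (ℤ; +_; 0ℤ; 1ℤ; -1ℤ; _+_; _*_; _-_; -_; _≤_)
open import Data.Integer.Solver using (module +-*-Solver)
open import Data.Product using (_×_; ∃-syntax)
open import Data.Sum using (_⊎_)
open import Relation.Binary.PropositionalEquality using (_≡_; refl)
open import Relation.Unary using (Pred; _∈_; _∪_; ｛_｝)
open import Level using (0ℓ)

-- ℤ[ρ] = ℤ[x]/(x³ - a x² - (a+3) x - 1): since the cubic is irreducible over ℚ,
-- every element is uniquely x + y ρ + z ρ², represented by ⟨ x , y , z ⟩.
record ℤ[ρ] (a : ℤ) : Set where
  constructor ⟨_,_,_⟩
  field
    c₀ c₁ c₂ : ℤ

open ℤ[ρ] public

module _ {a : ℤ} where

  infixl 6 _⊕_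
  infixl 7 _⊙_
  infixl 7 _•_

  ι : ℤ → ℤ[ρ] a
  ι n = ⟨ n , 0ℤ , 0ℤ ⟩

  ρ : ℤ[ρ] a
  ρ = ⟨ 0ℤ , 1ℤ , 0ℤ ⟩

  _⊕_ : ℤ[ρ] a → ℤ[ρ] a → ℤ[ρ] a
  ⟨ x , y , z ⟩ ⊕ ⟨ x′ , y′ , z′ ⟩ = ⟨ x + x′ , y + y′ , z + z′ ⟩

  _•_ : ℤ → ℤ[ρ] a → ℤ[ρ] a
  n • ⟨ x , y , z ⟩ = ⟨ n * x , n * y , n * z ⟩

  -- Multiplication by ρ, using ρ³ = 1 + (a+3) ρ + a ρ².
  ρ· : ℤ[ρ] a → ℤ[ρ] a
  ρ· ⟨ x , y , z ⟩ = ⟨ z , x + (a + + 3) * z , y + a * z ⟩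

  _⊙_ : ℤ[ρ] a → ℤ[ρ] a → ℤ[ρ] a
  ⟨ x , y , z ⟩ ⊙ β = x • β ⊕ y • ρ· β ⊕ z • ρ· (ρ· β)

  -- The other two roots of the cubic.  ρ′ = -1 - 1/ρ and ρ″ = -1/(1+ρ) (see ρ′-spec
  -- and ρ″-spec), so a+1 < ρ gives -2 < ρ′ < -1 and -1 < ρ″ < 0.
  ρ′ ρ″ : ℤ[ρ] a
  ρ′ = ⟨ a + + 2 , a , -1ℤ ⟩
  ρ″ = ⟨ - + 2 , - (a + 1ℤ) , 1ℤ ⟩

  -- x + y θ + z θ² for β = x + y ρ + z ρ²; with θ a root of the cubic this is the
  -- image of β under the embedding sending ρ to θ.
  _[_] : ℤ[ρ] a → ℤ[ρ] a → ℤ[ρ] a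
  ⟨ x , y , z ⟩ [ θ ] = ι x ⊕ y • θ ⊕ z • (θ ⊙ θ)

  conjugateProduct : ℤ[ρ] a → ℤ[ρ] a
  conjugateProduct β = β [ ρ ] ⊙ β [ ρ′ ] ⊙ β [ ρ″ ]

  N : ℤ[ρ] a → ℤ
  N β = c₀ (conjugateProduct β)

ext : ∀ {a} {β β′ : ℤ[ρ] a} → c₀ β ≡ c₀ β′ → c₁ β ≡ c₁ β′ → c₂ β ≡ c₂ β′ → β ≡ β′
ext refl refl refl = refl

-- The arithmetic of ℤ[ρ] on syntactic polynomials, mirrored clause by clause so that
-- the ring solver's equations hold definitionally for the operations above.
module Syntactic {n} (a : +-*-Solver.Polynomial n) where

  open +-*-Solver

  record Triple : Set where
    constructor ⟪_,_,_⟫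
    field
      k₀ k₁ k₂ : Polynomial n

  open Triple public

  infixl 6 _⊞_
  infixl 7 _⊠_ _∙_

  κ : Polynomial n → Triple
  κ x = ⟪ x , con 0ℤ , con 0ℤ ⟫

  _⊞_ : Triple → Triple → Triple
  ⟪ x , y , z ⟫ ⊞ ⟪ x′ , y′ , z′ ⟫ = ⟪ x :+ x′ , y :+ y′ , z :+ z′ ⟫

  _∙_ : Polynomial n → Triple → Triple
  m ∙ ⟪ x , y , z ⟫ = ⟪ m :* x , m :* y , m :* z ⟫

  r· : Triple → Triple
  r· ⟪ x , y , z ⟫ = ⟪ z , x :+ (a :+ con (+ 3)) :* z , y :+ a :* z ⟫

  _⊠_ : Triple → Triple → Triple
  ⟪ x , y , z ⟫ ⊠ t = x ∙ t ⊞ y ∙ r· t ⊞ z ∙ r· (r· t)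

  r r′ r″ : Triple
  r = ⟪ con 0ℤ , con 1ℤ , con 0ℤ ⟫
  r′ = ⟪ a :+ con (+ 2) , a , con -1ℤ ⟫
  r″ = ⟪ con (- + 2) , :- (a :+ con 1ℤ) , con 1ℤ ⟫

  _at_ : Triple → Triple → Triple
  ⟪ x , y , z ⟫ at t = κ x ⊞ y ∙ t ⊞ z ∙ (t ⊠ t)

  product : Triple → Triple
  product t = (t at r) ⊠ (t at r′) ⊠ (t at r″)

module _ {a : ℤ} where
  open +-*-Solver

  basis : (x y z : ℤ) → ⟨ x , y , z ⟩ ≡ ι {a} x ⊕ y • ρ ⊕ z • (ρ ⊙ ρ)
  basis x y z = ext
    (solve 4 (λ a x y z → let open Syntactic a in k₀ (⟪ x , y , z ⟫) := k₀ (κ x ⊞ y ∙ r ⊞ z ∙ (r ⊠ r))) refl a x y z)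
    (solve 4 (λ a x y z → let open Syntactic a in k₁ (⟪ x , y , z ⟫) := k₁ (κ x ⊞ y ∙ r ⊞ z ∙ (r ⊠ r))) refl a x y z)
    (solve 4 (λ a x y z → let open Syntactic a in k₂ (⟪ x , y , z ⟫) := k₂ (κ x ⊞ y ∙ r ⊞ z ∙ (r ⊠ r))) refl a x y z)

  ⊙-comm : (β δ : ℤ[ρ] a) → β ⊙ δ ≡ δ ⊙ β
  ⊙-comm ⟨ x , y , z ⟩ ⟨ x′ , y′ , z′ ⟩ = ext
    (solve 7 (λ a x y z x′ y′ z′ → let open Syntactic a in k₀ (⟪ x , y , z ⟫ ⊠ ⟪ x′ , y′ , z′ ⟫)
       := k₀ (⟪ x′ , y′ , z′ ⟫ ⊠ ⟪ x , y , z ⟫)) refl a x y z x′ y′ z′)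
    (solve 7 (λ a x y z x′ y′ z′ → let open Syntactic a in k₁ (⟪ x , y , z ⟫ ⊠ ⟪ x′ , y′ , z′ ⟫)
       := k₁ (⟪ x′ , y′ , z′ ⟫ ⊠ ⟪ x , y , z ⟫)) refl a x y z x′ y′ z′)
    (solve 7 (λ a x y z x′ y′ z′ → let open Syntactic a in k₂ (⟪ x , y , z ⟫ ⊠ ⟪ x′ , y′ , z′ ⟫)
       := k₂ (⟪ x′ , y′ , z′ ⟫ ⊠ ⟪ x , y , z ⟫)) refl a x y z x′ y′ z′)

  ⊙-assoc : (β δ ε : ℤ[ρ] a) → (β ⊙ δ) ⊙ ε ≡ β ⊙ (δ ⊙ ε)
  ⊙-assoc ⟨ x , y , z ⟩ ⟨ x′ , y′ , z′ ⟩ ⟨ x″ , y″ , z″ ⟩ = ext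
    (solve 10 (λ a x y z x′ y′ z′ x″ y″ z″ → let open Syntactic a in k₀ ((⟪ x , y , z ⟫ ⊠ ⟪ x′ , y′ , z′ ⟫) ⊠ ⟪ x″ , y″ , z″ ⟫)
       := k₀ (⟪ x , y , z ⟫ ⊠ (⟪ x′ , y′ , z′ ⟫ ⊠ ⟪ x″ , y″ , z″ ⟫))) refl a x y z x′ y′ z′ x″ y″ z″)
    (solve 10 (λ a x y z x′ y′ z′ x″ y″ z″ → let open Syntactic a in k₁ ((⟪ x , y , z ⟫ ⊠ ⟪ x′ , y′ , z′ ⟫) ⊠ ⟪ x″ , y″ , z″ ⟫)
       := k₁ (⟪ x , y , z ⟫ ⊠ (⟪ x′ , y′ , z′ ⟫ ⊠ ⟪ x″ , y″ , z″ ⟫))) refl a x y z x′ y′ z′ x″ y″ z″)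
    (solve 10 (λ a x y z x′ y′ z′ x″ y″ z″ → let open Syntactic a in k₂ ((⟪ x , y , z ⟫ ⊠ ⟪ x′ , y′ , z′ ⟫) ⊠ ⟪ x″ , y″ , z″ ⟫)
       := k₂ (⟪ x , y , z ⟫ ⊠ (⟪ x′ , y′ , z′ ⟫ ⊠ ⟪ x″ , y″ , z″ ⟫))) refl a x y z x′ y′ z′ x″ y″ z″)

  ρ′-spec : ρ ⊙ (ι {a} 1ℤ ⊕ ρ′) ≡ ι -1ℤ
  ρ′-spec = ext
    (solve 1 (λ a → let open Syntactic a in k₀ (r ⊠ (κ (con 1ℤ) ⊞ r′)) := k₀ (κ (con -1ℤ))) refl a)
    (solve 1 (λ a → let open Syntactic a in k₁ (r ⊠ (κ (con 1ℤ) ⊞ r′)) := k₁ (κ (con -1ℤ))) refl a)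
    (solve 1 (λ a → let open Syntactic a in k₂ (r ⊠ (κ (con 1ℤ) ⊞ r′)) := k₂ (κ (con -1ℤ))) refl a)

  ρ″-spec : (ι {a} 1ℤ ⊕ ρ) ⊙ ρ″ ≡ ι -1ℤ
  ρ″-spec = ext
    (solve 1 (λ a → let open Syntactic a in k₀ ((κ (con 1ℤ) ⊞ r) ⊠ r″) := k₀ (κ (con -1ℤ))) refl a)
    (solve 1 (λ a → let open Syntactic a in k₁ ((κ (con 1ℤ) ⊞ r) ⊠ r″) := k₁ (κ (con -1ℤ))) refl a)
    (solve 1 (λ a → let open Syntactic a in k₂ ((κ (con 1ℤ) ⊞ r) ⊠ r″) := k₂ (κ (con -1ℤ))) refl a)

  -- Vieta: x³ - a x² - (a+3) x - 1 = (x - ρ)(x - ρ′)(x - ρ″).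
  roots-e₁ : ρ ⊕ ρ′ ⊕ ρ″ ≡ ι {a} a
  roots-e₁ = ext
    (solve 1 (λ a → let open Syntactic a in k₀ (r ⊞ r′ ⊞ r″) := k₀ (κ a)) refl a)
    (solve 1 (λ a → let open Syntactic a in k₁ (r ⊞ r′ ⊞ r″) := k₁ (κ a)) refl a)
    (solve 1 (λ a → let open Syntactic a in k₂ (r ⊞ r′ ⊞ r″) := k₂ (κ a)) refl a)

  roots-e₂ : ρ ⊙ ρ′ ⊕ ρ ⊙ ρ″ ⊕ ρ′ ⊙ ρ″ ≡ ι {a} (- (a + + 3))
  roots-e₂ = ext
    (solve 1 (λ a → let open Syntactic a in k₀ (r ⊠ r′ ⊞ r ⊠ r″ ⊞ r′ ⊠ r″)
       := k₀ (κ (:- (a :+ con (+ 3))))) refl a)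
    (solve 1 (λ a → let open Syntactic a in k₁ (r ⊠ r′ ⊞ r ⊠ r″ ⊞ r′ ⊠ r″)
       := k₁ (κ (:- (a :+ con (+ 3))))) refl a)
    (solve 1 (λ a → let open Syntactic a in k₂ (r ⊠ r′ ⊞ r ⊠ r″ ⊞ r′ ⊠ r″)
       := k₂ (κ (:- (a :+ con (+ 3))))) refl a)

  roots-e₃ : ρ ⊙ ρ′ ⊙ ρ″ ≡ ι {a} 1ℤ
  roots-e₃ = ext
    (solve 1 (λ a → let open Syntactic a in k₀ (r ⊠ r′ ⊠ r″) := k₀ (κ (con 1ℤ))) refl a)
    (solve 1 (λ a → let open Syntactic a in k₁ (r ⊠ r′ ⊠ r″) := k₁ (κ (con 1ℤ))) refl a)
    (solve 1 (λ a → let open Syntactic a in k₂ (r ⊠ r′ ⊠ r″) := k₂ (κ (con 1ℤ))) refl a)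

  -- The norm is a rational integer, so reading off c₀ loses nothing.
  N-spec : (β : ℤ[ρ] a) → conjugateProduct β ≡ ι (N β)
  N-spec ⟨ x , y , z ⟩ = ext refl
    (solve 4 (λ a x y z → let open Syntactic a in k₁ (product ⟪ x , y , z ⟫) := con 0ℤ) refl a x y z)
    (solve 4 (λ a x y z → let open Syntactic a in k₂ (product ⟪ x , y , z ⟫) := con 0ℤ) refl a x y z)

module _ (a : ℤ) where

  α : ℤ → ℤ → ℤ[ρ] a
  α v W = ⟨ - v , - (v * (a + + 2) + 1ℤ + W) , v + 1ℤ ⟩

  γ : ℤ[ρ] a
  γ = ⟨ a * a + a + + 8 , a * a - a + 1ℤ , + 2 - a ⟩

  -- { α(v,W) : 0 ≤ v ≤ V, v ≤ W ≤ a - 2v - 1 }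
  rows≤ : ℤ → Pred (ℤ[ρ] a) 0ℓ
  rows≤ V β = ∃[ v ] ∃[ W ]
    0ℤ ≤ v × v ≤ V × v ≤ W × W ≤ a - + 2 * v - 1ℤ × β ≡ α v W

  ▲₀ : Pred (ℤ[ρ] a) 0ℓ
  ▲₀ β = ∃[ A ] ∃[ a₀ ] a ≡ + 3 * A + a₀ ×
    ( ((a₀ ≡ + 1 ⊎ a₀ ≡ + 2) × β ∈ rows≤ A)
    ⊎ (a₀ ≡ + 0 × β ∈ rows≤ (A - 1ℤ) ∪ ｛ α A A ｝))

{-# OPTIONS --safe #-}

-- N is multiplicative, so the hypothesis says N(α)² ≤ N(γ).  Off the row v = 0 and the point
-- (v,W) = (1,1), the norm N(α(v,W)) is at least its value m = 3a² + 9a - 37 at (1,2): in terms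
-- of the distances of (v,W) to the sides of the triangle, N(α(v,W)) - m is a polynomial with
-- nonnegative coefficients.  Finally m² - N(γ) is a cubic in a whose expansion around a = 15
-- has positive coefficients.
module Submission where

open import Defs
open import Data.Empty using (⊥-elim)
open import Data.Integer using (ℤ; +_; 0ℤ; 1ℤ; _+_; _*_; _-_; -_; _≤_; _<_; +≤+; nonNegative)
open import Data.Integer.Properties using (+-comm; +-identityʳ; +-mono-≤; +-monoˡ-≤; +-monoʳ-≤; +-mono-<-≤; *-monoˡ-≤-nonNeg; *-monoʳ-≤-nonNeg; *-monoˡ-<-pos; *-zeroˡ; ≤-refl; ≤-reflexive; ≤-trans; <-≤-trans; <⇒≱; ≮⇒≥; i≤i+j; i≤j⇒0≤j-i; suc[i]≤j⇒i<j)
open import Data.Integer.Solver using (module +-*-Solver)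
open import Data.Nat using (suc; z≤n; s≤s)
open import Data.Nat.Properties using (m≤m+n)
open import Data.Product using (_×_; ∃-syntax; _,_)
open import Data.Sum using (inj₁; inj₂)
open import Relation.Binary.PropositionalEquality using (_≡_; refl; sym; subst; subst₂)
open import Relation.Nullary using (¬_)
open import Relation.Unary using (_∈_; _∪_; ｛_｝)

open +-*-Solver using (Polynomial; solve; _:=_; _:+_; _:*_; _:-_; :-_; con)

infixl 6 _⊹_
infixl 7 _⊛_

-- Terms built from `_⊹_`, `_⊛_` and `0≤+` copy the Horner form of a polynomial with nonnegative
-- coefficients and so certify its sign.
_⊹_ : ∀ {i j} → 0ℤ ≤ i → 0ℤ ≤ j → 0ℤ ≤ i + j
_⊹_ = +-mono-≤

_⊛_ : ∀ {i j} → 0ℤ ≤ i → 0ℤ ≤ j → 0ℤ ≤ i * j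
_⊛_ {i} {j} 0≤i 0≤j = subst (_≤ i * j) (*-zeroˡ j) (*-monoʳ-≤-nonNeg j {{nonNegative 0≤j}} 0≤i)

0≤+ : ∀ n → 0ℤ ≤ + n
0≤+ _ = +≤+ z≤n

square-mono-≤ : ∀ {i j} → 0ℤ ≤ i → i ≤ j → i * i ≤ j * j
square-mono-≤ {i} {j} 0≤i i≤j = ≤-trans
  (*-monoˡ-≤-nonNeg i {{nonNegative 0≤i}} i≤j)
  (*-monoʳ-≤-nonNeg j {{nonNegative (≤-trans 0≤i i≤j)}} i≤j)

-- Splits an inequality into an identity for the ring solver and a nonnegativity certificate.
≤-by : ∀ {i j k} → j ≡ i + k → 0ℤ ≤ k → i ≤ j
≤-by {i} j≡i+k 0≤k = subst₂ _≤_ (+-identityʳ i) (sym j≡i+k) (+-monoʳ-≤ i 0≤k)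

αˢ : ∀ {n} (a v W : Polynomial n) → Syntactic.Triple a
αˢ a v W = ⟪ :- v , :- (v :* (a :+ con (+ 2)) :+ con 1ℤ :+ W) , v :+ con 1ℤ ⟫
  where open Syntactic a

N-square : ∀ {a} (β : ℤ[ρ] a) → N (β ⊙ β) ≡ N β * N β
N-square {a} ⟨ x , y , z ⟩ = solve 4 (λ a x y z → let open Syntactic a; t = ⟪ x , y , z ⟫ in
  k₀ (product (t ⊠ t)) := k₀ (product t) :* k₀ (product t)) refl a x y z

module _ (a : ℤ) where

  m : ℤ
  m = + 3 * (a * a) + + 9 * a - + 37

  N[γ]<m² : + 15 ≤ a → N (γ a) < m * m
  N[γ]<m² 15≤a = suc[i]≤j⇒i<j (≤-by
    (solve 1 (λ a → let open Syntactic a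
                        b = a :- con (+ 15)
                        m = con (+ 3) :* (a :* a) :+ con (+ 9) :* a :- con (+ 37)
                        γ = ⟪ a :* a :+ a :+ con (+ 8) , a :* a :- a :+ con (+ 1) , con (+ 2) :- a ⟫ in
      -- The summand 1 makes the inequality strict. The whole difference, with constant term 6716,
      -- equals -1300 at `b = -1`, so it is negative at `a = 14`.
      m :* m := (con (+ 1) :+ k₀ (product γ))
        :+ (b :* (b :* (con (+ 32) :* b :+ con (+ 1052)) :+ con (+ 9036)) :+ con (+ 6715))) refl a)
    (b ⊛ (b ⊛ (0≤+ 32 ⊛ b ⊹ 0≤+ 1052) ⊹ 0≤+ 9036) ⊹ 0≤+ 6715))
    where b = i≤j⇒0≤j-i 15≤a

  0≤m : + 15 ≤ a → 0ℤ ≤ m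
  0≤m 15≤a = ≤-by
    (solve 1 (λ a → let b = a :- con (+ 15) in
      con (+ 3) :* (a :* a) :+ con (+ 9) :* a :- con (+ 37)
        := con (+ 0) :+ (b :* (con (+ 3) :* b :+ con (+ 99)) :+ con (+ 773))) refl a)
    (b ⊛ (0≤+ 3 ⊛ b ⊹ 0≤+ 99) ⊹ 0≤+ 773)
    where b = i≤j⇒0≤j-i 15≤a

  -- Row 1 has to start at `W = 2`: the remainder vanishes there, while at `W = 1` it is -(u² + 11u)
  -- with `u = a - 4`, hence negative.
  m≤N[α1W] : ∀ {W} → + 2 ≤ W → W + + 3 ≤ a → m ≤ N (α a 1ℤ W)
  m≤N[α1W] {W} 2≤W W+3≤a = ≤-by
    (solve 2 (λ a W → let open Syntactic a
                          t = W :- con (+ 2)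
                          u = a :- (W :+ con (+ 3)) in
      k₀ (product (αˢ a (con 1ℤ) W))
        := (con (+ 3) :* (a :* a) :+ con (+ 9) :* a :- con (+ 37))
        :+ t :* (t :* (con (+ 2) :* u :+ con (+ 1)) :+ u :* (u :+ con (+ 13)) :+ con (+ 1))) refl a W)
    (t ⊛ (t ⊛ (0≤+ 2 ⊛ u ⊹ 0≤+ 1) ⊹ u ⊛ (u ⊹ 0≤+ 13) ⊹ 0≤+ 1))
    where
    t = i≤j⇒0≤j-i 2≤W
    u = i≤j⇒0≤j-i W+3≤a

  -- The bound W ≤ a - 2v, weaker than that of the rows, admits α(A,A) for a = 3A.
  m≤N[αvW] : ∀ {v W} → + 2 ≤ v → v ≤ W → W + + 2 * v ≤ a → m ≤ N (α a v W)
  m≤N[αvW] {v} {W} 2≤v v≤W W+2v≤a = ≤-by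
    (solve 3 (λ a v W → let open Syntactic a
                            s = v :- con (+ 2)
                            t = W :- v
                            u = a :- (W :+ con (+ 2) :* v) in
      k₀ (product (αˢ a v W))
        := (con (+ 3) :* (a :* a) :+ con (+ 9) :* a :- con (+ 37))
        :+ (s :* (s :* (s :* (con (+ 3) :* s :+ con (+ 4) :* t :+ con (+ 4) :* u :+ con (+ 30))
             :+ (t :* (t :+ con (+ 5) :* u :+ con (+ 30)) :+ u :* (u :+ con (+ 30)) :+ con (+ 90)))
             :+ (t :* (t :* (u :+ con (+ 5)) :+ u :* (u :+ con (+ 25)) :+ con (+ 60))
               :+ u :* (con (+ 5) :* u :+ con (+ 60)) :+ con (+ 75)))
             :+ (t :* (t :* (con (+ 3) :* u :+ con (+ 3)) :+ u :* (con (+ 2) :* u :+ con (+ 27)) :+ con (+ 25))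
               :+ u :* (con (+ 3) :* u :+ con (+ 25)) :+ con (+ 22)))) refl a v W)
    (s ⊛ (s ⊛ (s ⊛ (0≤+ 3 ⊛ s ⊹ 0≤+ 4 ⊛ t ⊹ 0≤+ 4 ⊛ u ⊹ 0≤+ 30)
      ⊹ (t ⊛ (t ⊹ 0≤+ 5 ⊛ u ⊹ 0≤+ 30) ⊹ u ⊛ (u ⊹ 0≤+ 30) ⊹ 0≤+ 90))
      ⊹ (t ⊛ (t ⊛ (u ⊹ 0≤+ 5) ⊹ u ⊛ (u ⊹ 0≤+ 25) ⊹ 0≤+ 60) ⊹ u ⊛ (0≤+ 5 ⊛ u ⊹ 0≤+ 60) ⊹ 0≤+ 75))
      ⊹ (t ⊛ (t ⊛ (0≤+ 3 ⊛ u ⊹ 0≤+ 3) ⊹ u ⊛ (0≤+ 2 ⊛ u ⊹ 0≤+ 27) ⊹ 0≤+ 25) ⊹ u ⊛ (0≤+ 3 ⊛ u ⊹ 0≤+ 25) ⊹ 0≤+ 22))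
    where
    s = i≤j⇒0≤j-i 2≤v
    t = i≤j⇒0≤j-i v≤W
    u = i≤j⇒0≤j-i W+2v≤a

  -- Otherwise N(γ) < m² ≤ N(β)² = N(β²); squaring preserves the order because `m` is nonnegative.
  m≰N : + 15 ≤ a → (β : ℤ[ρ] a) → N (β ⊙ β) ≤ N (γ a) → ¬ m ≤ N β
  m≰N 15≤a β Nβ²≤Nγ m≤Nβ = <⇒≱
    (<-≤-trans (N[γ]<m² 15≤a) (square-mono-≤ {m} {N β} (0≤m 15≤a) m≤Nβ))
    (subst (_≤ N (γ a)) (N-square β) Nβ²≤Nγ)

  Small : ℤ[ρ] a → Set
  Small = (λ δ → ∃[ w ] + 1 ≤ w × w ≤ a × δ ≡ ⟨ + 0 , - w , + 1 ⟩)
    ∪ ｛ ⟨ + 1 , + 1 , + 1 ⟩ ｝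
    ∪ ｛ ⟨ - (+ 1) , - (a + + 4) , + 2 ⟩ ｝

  -- For a numeral `v` the bracket computes, to 1 on row 0 and to 3 on row 1.
  shift-bound : ∀ v W → W ≤ a - + 2 * v - 1ℤ → W + (+ 2 * v + 1ℤ) ≤ a
  shift-bound v W W≤ = subst (W + (+ 2 * v + 1ℤ) ≤_)
    (solve 2 (λ a v → a :- con (+ 2) :* v :- con 1ℤ :+ (con (+ 2) :* v :+ con 1ℤ) := a) refl a v)
    (+-monoˡ-≤ (+ 2 * v + 1ℤ) W≤)

  rows-small : + 15 ≤ a → ∀ V {β} → β ∈ rows≤ a V → N (β ⊙ β) ≤ N (γ a) → β ∈ Small
  -- Here α(0,W) = -(1+W)ρ + ρ², so `0 ≤ W ≤ a - 1` becomes `1 ≤ w ≤ a` for `w = 1 + W`.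
  rows-small 15≤a _ (+ 0 , W , _ , _ , 0≤W , W≤ , refl) _ =
    inj₁ (1ℤ + W , +-monoʳ-≤ 1ℤ 0≤W , subst (_≤ a) (+-comm W 1ℤ) (shift-bound 0ℤ W W≤) , refl)
  rows-small 15≤a _ (+ 1 , + 0 , _ , _ , +≤+ () , _)
  -- The exceptional point: (a + 2) + 1 + 1 = a + 4.
  rows-small 15≤a _ (+ 1 , + 1 , _ , _ , _ , _ , refl) _ =
    inj₂ (inj₂ (ext refl (solve 1 (λ a → :- (a :+ con (+ 4))
      := :- (con 1ℤ :* (a :+ con (+ 2)) :+ con 1ℤ :+ con 1ℤ)) refl a) refl))
  rows-small 15≤a _ (+ 1 , W@(+ suc (suc _)) , _ , _ , _ , W≤ , refl) N≤ =
    ⊥-elim (m≰N 15≤a (α a 1ℤ W) N≤ (m≤N[α1W] (+≤+ (s≤s (s≤s z≤n))) (shift-bound 1ℤ W W≤)))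
  rows-small 15≤a _ (v@(+ suc (suc _)) , W , _ , _ , v≤W , W≤ , refl) N≤ =
    ⊥-elim (m≰N 15≤a (α a v W) N≤ (m≤N[αvW] (+≤+ (s≤s (s≤s z≤n))) v≤W
      (≤-trans (+-monoʳ-≤ W (i≤i+j (+ 2 * v) 1ℤ)) (shift-bound v W W≤))))

-- From `A < 2` would follow 3A < 6 ≤ 15. This puts α(A,A) in the range `2 ≤ v`.
2≤third : ∀ A → + 15 ≤ + 3 * A + + 0 → + 2 ≤ A
2≤third A 15≤3A = ≮⇒≥ λ A<2 → <⇒≱ (+-mono-<-≤ (*-monoˡ-<-pos (+ 3) A<2) ≤-refl)
  (≤-trans (+≤+ (m≤m+n 6 9)) 15≤3A)

lemma3p2 : (a : ℤ) → + 15 ≤ a →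
    (β : ℤ[ρ] a) → β ∈ ▲₀ a ∪ ｛ ⟨ + 1 , + 1 , + 1 ⟩ ｝ →
    N (β ⊙ β) ≤ N (γ a) →
    β ∈ (λ δ → ∃[ w ] + 1 ≤ w × w ≤ a × δ ≡ ⟨ + 0 , - w , + 1 ⟩)
    ∪ ｛ ⟨ + 1 , + 1 , + 1 ⟩ ｝
    ∪ ｛ ⟨ - (+ 1) , - (a + + 4) , + 2 ⟩ ｝
lemma3p2 a 15≤a β (inj₂ refl) _ = inj₂ (inj₁ refl)
lemma3p2 a 15≤a β (inj₁ (A , _ , _ , inj₁ (_ , β∈rows))) N≤ = rows-small a 15≤a A β∈rows N≤
lemma3p2 a 15≤a β (inj₁ (A , _ , _ , inj₂ (_ , inj₁ β∈rows))) N≤ = rows-small a 15≤a (A - 1ℤ) β∈rows N≤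
lemma3p2 a 15≤a β (inj₁ (A , _ , refl , inj₂ (refl , inj₂ refl))) N≤ =
  -- At `v = W = A` the sum W + 2v is exactly 3A = a, one more than the rows allow.
  ⊥-elim (m≰N a 15≤a β N≤ (m≤N[αvW] a (2≤third A 15≤a) ≤-refl
    (≤-reflexive (solve 1 (λ A → A :+ con (+ 2) :* A := con (+ 3) :* A :+ con (+ 0)) refl A))))
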